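{- Let $m\ge 1$, $r\ge 0$ and $n\ge 0$ be integers. Then the $r$-Dowling numbers $D_{m,r}(n)=\sum_{k=0}^n W_{m,r}(n,k)$ satisfy $$D_{m,r}(n)=\sum_{j=0}^{n}(-1)^{n-j}\left[\sum_{k=0}^{j}L_{m,r}(j,k)\right]W_{m,r}(n,j),$$ where $W_{m,r}(n,j)$ are the $r$-Whitney numbers of the second kind and $L_{m,r}(j,k)$ are the $r$-Whitney-Lah numbers.
   Context: Write $(x)_n=x(x-1)\cdots(x-n+1)$, $(x)_0=1$, for the falling factorial. The $r$-Whitney numbers of the first kind $w_{m,r}(n,k)$ and of the second kind $W_{m,r}(n,k)$, $0\le k\le n$, are defined by the polynomial identities in $x$ $$m^n(x)_n=\sum_{k=0}^n(-1)^{n-k}w_{m,r}(n,k)(mx+r)^k,\qquad (mx+r)^n=\sum_{k=0}^nm^kW_{m,r}(n,k)(x)_k .$$ The $r$-Whitney-Lah numbers are defined by $$L_{m,r}(n,k)=\sum_{j=k}^{n}w_{m,r}(n,j)W_{m,r}(j,k),\qquad 0\le k\le n.$$ The $r$-Dowling numbers are $D_{m,r}(n)=\sum_{k=0}^n W_{m,r}(n,k)$. -}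

module Defs where

open import Algebra.Bundles.Raw using (RawMonoid; RawRing; RawSemiring)
import Algebra.Definitions.RawMonoid as RawMonoidDefs
import Algebra.Definitions.RawSemiring as RawSemiringDefs
open import Data.Fin.Base using (toℕ)
open import Data.Integer.Base using (+_)
open import Data.List.Base using (List; []; _∷_; map)
open import Data.Nat.Base as ℕ using (ℕ; zero; suc; _∸_)
open import Data.Rational.Base as ℚ using (ℚ; 0ℚ; 1ℚ; +-*-rawSemiring)
open import Level using (0ℓ)
open import Relation.Binary.PropositionalEquality.Core using (_≡_)

-- ∑[ a ⋯ b ] f = f a + f (a + 1) + … + f b, both ends included; empty if b < a.
module Summation (M : RawMonoid 0ℓ 0ℓ) where
  open RawMonoid M using (Carrier)
  open RawMonoidDefs M using (sum)

  ∑[_⋯_] : ℕ → ℕ → (ℕ → Carrier) → Carrier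
  ∑[ a ⋯ b ] f = sum {suc b ∸ a} (λ i → f (a ℕ.+ toℕ i))

open Summation (RawSemiring.+-rawMonoid +-*-rawSemiring) public
open RawSemiringDefs +-*-rawSemiring public using (_^_)

ι : ℕ → ℚ
ι n = + n ℚ./ 1

sgn : ℕ → ℚ
sgn k = (ℚ.- 1ℚ) ^ k

-- Polynomials over ℚ: lists of coefficients, constant term first.  Trailing
-- zeros are allowed, so equality of polynomials is _≈ᴾ_ and not _≡_ of lists.

Poly : Set
Poly = List ℚ

coeff : Poly → ℕ → ℚ
coeff []      _       = 0ℚ
coeff (a ∷ _) zero    = a
coeff (_ ∷ p) (suc i) = coeff p i

infix 4 _≈ᴾ_
_≈ᴾ_ : Poly → Poly → Set
p ≈ᴾ q = ∀ i → coeff p i ≡ coeff q i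

infixl 6 _+ᴾ_
_+ᴾ_ : Poly → Poly → Poly
[]      +ᴾ q       = q
p       +ᴾ []      = p
(a ∷ p) +ᴾ (b ∷ q) = (a ℚ.+ b) ∷ (p +ᴾ q)

infixl 7 _*ᴾ_
_*ᴾ_ : Poly → Poly → Poly
[]      *ᴾ q = []
(a ∷ p) *ᴾ q = map (a ℚ.*_) q +ᴾ (0ℚ ∷ (p *ᴾ q))

infix 8 -ᴾ_
-ᴾ_ : Poly → Poly
-ᴾ_ = map (λ a → ℚ.- a)

const : ℚ → Poly
const a = a ∷ []

X : Poly
X = 0ℚ ∷ 1ℚ ∷ []

polyRawRing : RawRing 0ℓ 0ℓ
polyRawRing = record
  { Carrier = Poly
  ; _≈_     = _≈ᴾ_
  ; _+_     = _+ᴾ_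
  ; _*_     = _*ᴾ_
  ; -_      = -ᴾ_
  ; 0#      = []
  ; 1#      = const 1ℚ
  }

open Summation (RawRing.+-rawMonoid polyRawRing) public
  renaming (∑[_⋯_] to ∑ᴾ[_⋯_])
open RawSemiringDefs (RawRing.rawSemiring polyRawRing) public
  using () renaming (_^_ to _^ᴾ_)

-- The falling factorial (x)ₙ of the indeterminate, as a polynomial.
falling : ℕ → Poly
falling zero    = const 1ℚ
falling (suc n) = falling n *ᴾ (X +ᴾ -ᴾ const (ι n))

-- The polynomial m x + r.
linear : ℕ → ℕ → Poly
linear m r = const (ι m) *ᴾ X +ᴾ const (ι r)

-- The identities defining the r-Whitney numbers.  For m ≥ 1 they determine
-- w n k and W n k exactly for 0 ≤ k ≤ n; values with k > n are unconstrained.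

IsWhitneyFirst : (m r : ℕ) → (ℕ → ℕ → ℚ) → Set
IsWhitneyFirst m r w = ∀ n →
  const (ι m ^ n) *ᴾ falling n
    ≈ᴾ ∑ᴾ[ 0 ⋯ n ] (λ k → const (sgn (n ∸ k) ℚ.* w n k) *ᴾ linear m r ^ᴾ k)

IsWhitneySecond : (m r : ℕ) → (ℕ → ℕ → ℚ) → Set
IsWhitneySecond m r W = ∀ n →
  linear m r ^ᴾ n
    ≈ᴾ ∑ᴾ[ 0 ⋯ n ] (λ k → const (ι m ^ k ℚ.* W n k) *ᴾ falling k)

whitneyLah : (w W : ℕ → ℕ → ℚ) → ℕ → ℕ → ℚ
whitneyLah w W n k = ∑[ k ⋯ n ] (λ j → w n j ℚ.* W j k)

dowling : (W : ℕ → ℕ → ℚ) → ℕ → ℚ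
dowling W n = ∑[ 0 ⋯ n ] (λ k → W n k)

{-# OPTIONS --safe #-}

-- Since m x + r has degree one, a linear functional on polynomials may be given
-- arbitrary values on the powers of m x + r.  Let F be the one with
-- F ((m x + r)ⁱ) = (-1)ⁱ D(i).  Applying F to the identity defining w gives
-- F (mʲ (x)ⱼ) = (-1)ʲ ∑ᵢ w(j,i) D(i) = (-1)ʲ ∑ₖ L(j,k), and applying F to the
-- identity defining W then gives (-1)ⁿ D(n) = ∑ⱼ W(n,j) (-1)ʲ ∑ₖ L(j,k).

module Submission where

open import Defs
open import Algebra.Bundles using (CommutativeRing)
open import Algebra.Bundles.Raw using (RawRing)
open import Algebra.Definitions.RawMonoid (RawRing.+-rawMonoid polyRawRing)
  using () renaming (sum to sumᴾ)
open import Data.Fin.Base using (Fin; toℕ)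
open import Data.Fin.Properties using (toℕ≤pred[n])
open import Data.List.Base using ([]; _∷_; map)
open import Data.Nat.Base using (ℕ; zero; suc; _≤_; _∸_)
open import Data.Nat.Properties using (m∸n+n≡m)
open import Data.Rational.Base using (ℚ; 0ℚ; 1ℚ; _+_; _*_; _-_; 1/_; NonZero)
open import Data.Rational.Properties
  using ( +-*-commutativeRing; normalize-pos; pos⇒nonZero; *-inverseʳ
        ; +-identityˡ; +-identityʳ; *-identityˡ; *-assoc)
open import Data.Rational.Solver using (module +-*-Solver)
open import Function.Base using (_∘_)
open import Relation.Binary.PropositionalEquality
open +-*-Solver
open ≡-Reasoning
open import Algebra.Properties.Semiring.Sum (CommutativeRing.semiring +-*-commutativeRing)
  using (sum; sum-cong-≗; ∑-distrib-+; *-distribˡ-sum)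
open import Algebra.Properties.Semiring.Exp (CommutativeRing.semiring +-*-commutativeRing)
  using (^-homo-*)

∑-cong : ∀ n {f g : ℕ → ℚ} → (∀ k → k ≤ n → f k ≡ g k) → ∑[ 0 ⋯ n ] f ≡ ∑[ 0 ⋯ n ] g
∑-cong n f≡g = sum-cong-≗ (λ i → f≡g (toℕ i) (toℕ≤pred[n] i))

*-distribˡ-∑ : ∀ a b c f → c * ∑[ a ⋯ b ] f ≡ ∑[ a ⋯ b ] (λ i → c * f i)
*-distribˡ-∑ a b c f = *-distribˡ-sum {suc b ∸ a} c _

-- Induction on `n` splits off the row `k = 0`. The other rows, with both indices lowered by one,
-- form a triangle of the next smaller size.
∑-triangle : ∀ n (f : ℕ → ℕ → ℚ) →
  ∑[ 0 ⋯ n ] (λ k → ∑[ k ⋯ n ] (f k)) ≡ ∑[ 0 ⋯ n ] (λ i → ∑[ 0 ⋯ i ] (λ k → f k i))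
∑-triangle zero    f = refl
∑-triangle (suc n) f = begin
  ∑[ 0 ⋯ suc n ] (f 0) + ∑[ 0 ⋯ n ] (λ k → ∑[ k ⋯ n ] (f (suc k) ∘ suc))
    ≡⟨ cong (∑[ 0 ⋯ suc n ] (f 0) +_) (∑-triangle n (λ k i → f (suc k) (suc i))) ⟩
  ∑[ 0 ⋯ suc n ] (f 0) + below
    -- The added `0ℚ` is the empty sum `∑⁺ 0`: column `i = 0` has an entry only in row 0.
    ≡⟨ cong (∑[ 0 ⋯ suc n ] (f 0) +_) (+-identityˡ below) ⟨
  ∑[ 0 ⋯ suc n ] (f 0) + (0ℚ + below)
    ≡⟨ ∑-distrib-+ {suc (suc n)} (f 0 ∘ toℕ) (λ i → ∑⁺ (toℕ i)) ⟨
  ∑[ 0 ⋯ suc n ] (λ i → ∑[ 0 ⋯ i ] (λ k → f k i)) ∎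
  where
  ∑⁺ : ℕ → ℚ
  ∑⁺ i = sum {i} (λ k → f (suc (toℕ k)) i)
  below = ∑[ 0 ⋯ n ] (λ i → ∑[ 0 ⋯ i ] (λ k → f (suc k) (suc i)))

sgn-square : ∀ k → sgn k * sgn k ≡ 1ℚ
sgn-square zero    = refl
sgn-square (suc k) = trans
  (solve 1 (λ s → (:- con 1ℚ :* s) :* (:- con 1ℚ :* s) := s :* s) refl (sgn k))
  (sgn-square k)

sgn-∸-* : ∀ {k n} → k ≤ n → sgn (n ∸ k) * sgn k ≡ sgn n
sgn-∸-* {k} {n} k≤n = trans (sym (^-homo-* _ (n ∸ k) k)) (cong sgn (m∸n+n≡m k≤n))

-- Each sign is its own inverse, so `sgn k` can be moved across `sgn-∸-*`.
sgn-∸ : ∀ {k n} → k ≤ n → sgn (n ∸ k) ≡ sgn n * sgn k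
sgn-∸ {k} {n} k≤n = begin
  sgn (n ∸ k)                    ≡⟨ solve 1 (λ s → s := s :* con 1ℚ) refl (sgn (n ∸ k)) ⟩
  sgn (n ∸ k) * 1ℚ               ≡⟨ cong (sgn (n ∸ k) *_) (sgn-square k) ⟨
  sgn (n ∸ k) * (sgn k * sgn k)  ≡⟨ *-assoc (sgn (n ∸ k)) (sgn k) (sgn k) ⟨
  sgn (n ∸ k) * sgn k * sgn k    ≡⟨ cong (_* sgn k) (sgn-∸-* k≤n) ⟩
  sgn n * sgn k                  ∎

-- Makes the leading coefficient of `linear m r` invertible, so that `X` can be expressed through
-- `linear m r`.
ι-nonZero : ∀ {m} → 1 ≤ m → NonZero (ι m)
ι-nonZero {suc m} _ = pos⇒nonZero (ι (suc m)) {{normalize-pos (suc m) 1}}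

-- Once the order of summation is exchanged, `w n i` is constant in the inner sum, which leaves a
-- full row sum of `W`.
∑-whitneyLah : ∀ w W n →
  ∑[ 0 ⋯ n ] (λ k → whitneyLah w W n k) ≡ ∑[ 0 ⋯ n ] (λ i → w n i * dowling W i)
∑-whitneyLah w W n = begin
  ∑[ 0 ⋯ n ] (λ k → whitneyLah w W n k)
    ≡⟨ ∑-triangle n (λ k i → w n i * W i k) ⟩
  ∑[ 0 ⋯ n ] (λ i → ∑[ 0 ⋯ i ] (λ k → w n i * W i k))
    ≡⟨ ∑-cong n (λ i _ → *-distribˡ-∑ 0 i (w n i) (W i)) ⟨
  ∑[ 0 ⋯ n ] (λ i → w n i * dowling W i) ∎

module LinearFunctional (μ ρ : ℚ) {{_ : NonZero μ}} where

  -- For `μ = ι m` and `ρ = ι r` this is `linear m r` by definition.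
  ℓ : Poly
  ℓ = const μ *ᴾ X +ᴾ const ρ

  -- The linear functional with ℓ ^ᴾ k ↦ a k: multiplying by ℓ shifts the values
  -- a, and X = (ℓ − ρ) / μ.
  functional : (ℕ → ℚ) → Poly → ℚ
  functional a []      = 0ℚ
  functional a (c ∷ p) = c * a 0 + 1/ μ * (functional (a ∘ suc) p - ρ * functional a p)

  private
    step-zero : ∀ a₀ → 0ℚ * a₀ + 1/ μ * (0ℚ - ρ * 0ℚ) ≡ 0ℚ
    step-zero a₀ =
      solve 3 (λ x s r → con 0ℚ :* x :+ s :* (con 0ℚ :- r :* con 0ℚ) := con 0ℚ) refl a₀ (1/ μ) ρ

  -- Equal polynomials may differ in trailing zeros. In the mixed cases the nonempty list has only
  -- zero coefficients, and `step-zero` removes them one at a time.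
  functional-cong : ∀ a p q → p ≈ᴾ q → functional a p ≡ functional a q
  functional-cong a []      []      p≈q = refl
  functional-cong a []      (c ∷ q) p≈q
    rewrite sym (p≈q 0)
          | sym (functional-cong a [] q (p≈q ∘ suc))
          | sym (functional-cong (a ∘ suc) [] q (p≈q ∘ suc)) = sym (step-zero (a 0))
  functional-cong a (c ∷ p) []      p≈q
    rewrite p≈q 0
          | functional-cong a p [] (p≈q ∘ suc)
          | functional-cong (a ∘ suc) p [] (p≈q ∘ suc) = step-zero (a 0)
  functional-cong a (c ∷ p) (d ∷ q) p≈q
    rewrite p≈q 0
          | functional-cong a p q (p≈q ∘ suc)
          | functional-cong (a ∘ suc) p q (p≈q ∘ suc) = refl

  functional-+ : ∀ a p q → functional a (p +ᴾ q) ≡ functional a p + functional a q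
  functional-+ a []      q       = sym (+-identityˡ _)
  functional-+ a (c ∷ p) []      = sym (+-identityʳ _)
  functional-+ a (c ∷ p) (d ∷ q)
    rewrite functional-+ a p q | functional-+ (a ∘ suc) p q =
    solve 9 (λ c d x s r u v u′ v′ →
        (c :+ d) :* x :+ s :* ((u′ :+ v′) :- r :* (u :+ v))
          := (c :* x :+ s :* (u′ :- r :* u)) :+ (d :* x :+ s :* (v′ :- r :* v)))
      refl c d (a 0) (1/ μ) ρ (functional a p) (functional a q)
      (functional (a ∘ suc) p) (functional (a ∘ suc) q)

  functional-scale : ∀ a c p → functional a (map (c *_) p) ≡ c * functional a p
  functional-scale a c []      = solve 1 (λ c → con 0ℚ := c :* con 0ℚ) refl c
  functional-scale a c (d ∷ p)
    rewrite functional-scale a c p | functional-scale (a ∘ suc) c p =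
    solve 7 (λ c d x s r u u′ →
        (c :* d) :* x :+ s :* (c :* u′ :- r :* (c :* u)) := c :* (d :* x :+ s :* (u′ :- r :* u)))
      refl c d (a 0) (1/ μ) ρ (functional a p) (functional (a ∘ suc) p)

  functional-const-* : ∀ a c p → functional a (const c *ᴾ p) ≡ c * functional a p
  functional-const-* a c p = begin
    -- `const c *ᴾ p` unfolds to this; the spurious `const 0ℚ` has value 0.
    functional a (map (c *_) p +ᴾ const 0ℚ)
      ≡⟨ functional-+ a (map (c *_) p) (const 0ℚ) ⟩
    functional a (map (c *_) p) + functional a (const 0ℚ)
      ≡⟨ cong₂ _+_ (functional-scale a c p) (step-zero (a 0)) ⟩
    c * functional a p + 0ℚ
      ≡⟨ +-identityʳ _ ⟩
    c * functional a p ∎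

  -- With `u` and `u′` the values of `p` under `a` and `a ∘ suc`, the product `X *ᴾ p` has value
  -- `(u′ - ρ u) / μ`, so `μ X + ρ` gives `(u′ - ρ u) + ρ u = u′`.
  functional-ℓ-* : ∀ a p → functional a (ℓ *ᴾ p) ≡ functional (a ∘ suc) p
  functional-ℓ-* a p = begin
    functional a (ℓ *ᴾ p)
      ≡⟨ functional-+ a (map (ℓ₀ *_) p) (0ℚ ∷ (const ℓ₁ *ᴾ p)) ⟩
    functional a (map (ℓ₀ *_) p) + functional a (0ℚ ∷ (const ℓ₁ *ᴾ p))
      ≡⟨ cong₂ _+_ (functional-scale a ℓ₀ p)
           (cong₂ (λ u′ u → 0ℚ * a 0 + 1/ μ * (u′ - ρ * u))
             (functional-const-* (a ∘ suc) ℓ₁ p) (functional-const-* a ℓ₁ p)) ⟩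
    ℓ₀ * u + (0ℚ * a 0 + 1/ μ * (ℓ₁ * u′ - ρ * (ℓ₁ * u)))
      ≡⟨ solve 6 (λ m s r x u u′ →
             (m :* con 0ℚ :+ con 0ℚ :+ r) :* u
               :+ (con 0ℚ :* x :+ s :* (m :* con 1ℚ :* u′ :- r :* (m :* con 1ℚ :* u)))
               := (m :* s) :* (u′ :- r :* u) :+ r :* u)
           refl μ (1/ μ) ρ (a 0) u u′ ⟩
    (μ * 1/ μ) * (u′ - ρ * u) + ρ * u
      ≡⟨ cong (λ t → t * (u′ - ρ * u) + ρ * u) (*-inverseʳ μ) ⟩
    1ℚ * (u′ - ρ * u) + ρ * u
      ≡⟨ solve 3 (λ r u u′ → con 1ℚ :* (u′ :- r :* u) :+ r :* u := u′) refl ρ u u′ ⟩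
    u′ ∎
    where
    u  = functional a p
    u′ = functional (a ∘ suc) p
    -- The two coefficients of `ℓ`, in the unsimplified form that list arithmetic produces.
    ℓ₀ = μ * 0ℚ + 0ℚ + ρ
    ℓ₁ = μ * 1ℚ

  -- Each factor `ℓ` shifts the sequence once, and the remaining constant 1 reads off its first
  -- term.
  functional-ℓ^ : ∀ a k → functional a (ℓ ^ᴾ k) ≡ a k
  functional-ℓ^ a zero    =
    solve 3 (λ x s r → con 1ℚ :* x :+ s :* (con 0ℚ :- r :* con 0ℚ) := x) refl (a 0) (1/ μ) ρ
  functional-ℓ^ a (suc k) = trans (functional-ℓ-* a (ℓ ^ᴾ k)) (functional-ℓ^ (a ∘ suc) k)

  functional-sum : ∀ a {n} (p : Fin n → Poly) →
    functional a (sumᴾ p) ≡ sum (functional a ∘ p)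
  functional-sum a {zero}  p = refl
  functional-sum a {suc n} p = trans (functional-+ a (p Fin.zero) _)
    (cong (functional a (p Fin.zero) +_) (functional-sum a (p ∘ Fin.suc)))

  -- Both defining identities of the Whitney numbers have this shape, so each becomes an identity
  -- between rationals.
  functional-expansion : ∀ a n (c : ℕ → ℚ) (p : ℕ → Poly) q →
    q ≈ᴾ ∑ᴾ[ 0 ⋯ n ] (λ k → const (c k) *ᴾ p k) →
    functional a q ≡ ∑[ 0 ⋯ n ] (λ k → c k * functional a (p k))
  functional-expansion a n c p q q≈∑ = begin
    functional a q
      ≡⟨ functional-cong a q (∑ᴾ[ 0 ⋯ n ] (λ k → const (c k) *ᴾ p k)) q≈∑ ⟩
    functional a (∑ᴾ[ 0 ⋯ n ] (λ k → const (c k) *ᴾ p k))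
      ≡⟨ functional-sum a {suc n} (λ i → const (c (toℕ i)) *ᴾ p (toℕ i)) ⟩
    ∑[ 0 ⋯ n ] (λ k → functional a (const (c k) *ᴾ p k))
      ≡⟨ ∑-cong n (λ k _ → functional-const-* a (c k) (p k)) ⟩
    ∑[ 0 ⋯ n ] (λ k → c k * functional a (p k)) ∎

theorem5p1 : (m r : ℕ) → 1 ≤ m →
    (w W : ℕ → ℕ → ℚ) → IsWhitneyFirst m r w → IsWhitneySecond m r W →
    (n : ℕ) →
    dowling W n
    ≡ ∑[ 0 ⋯ n ] (λ j → sgn (n ∸ j) * ∑[ 0 ⋯ j ] (λ k → whitneyLah w W j k) * W n j)
theorem5p1 m r 1≤m w W isFirst isSecond n = begin
  D n
    -- The functional yields `D n` only with the sign `sgn n`, so that sign is inserted twice.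
    ≡⟨ *-identityˡ (D n) ⟨
  1ℚ * D n
    ≡⟨ cong (_* D n) (sgn-square n) ⟨
  sgn n * sgn n * D n
    ≡⟨ *-assoc (sgn n) (sgn n) (D n) ⟩
  sgn n * (sgn n * D n)
    ≡⟨ cong (sgn n *_) signed-dowling ⟩
  sgn n * ∑[ 0 ⋯ n ] (λ j → W n j * (sgn j * L j))
    ≡⟨ *-distribˡ-∑ 0 n (sgn n) (λ j → W n j * (sgn j * L j)) ⟩
  ∑[ 0 ⋯ n ] (λ j → sgn n * (W n j * (sgn j * L j)))
    ≡⟨ ∑-cong n (λ j j≤n → trans
         (solve 4 (λ s x t l → s :* (x :* (t :* l)) := s :* t :* l :* x)
           refl (sgn n) (W n j) (sgn j) (L j))
         (cong (λ s → s * L j * W n j) (sym (sgn-∸ j≤n)))) ⟩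
  ∑[ 0 ⋯ n ] (λ j → sgn (n ∸ j) * L j * W n j) ∎
  where
  open LinearFunctional (ι m) (ι r) {{ι-nonZero 1≤m}}

  D : ℕ → ℚ
  D = dowling W

  L : ℕ → ℚ
  L j = ∑[ 0 ⋯ j ] (λ k → whitneyLah w W j k)

  -- The sign `sgn k` is chosen so that `sgn (j ∸ i)` from the identity for `w` combines with
  -- `sgn i` into `sgn j`, which leaves the sum over `i`.
  F : Poly → ℚ
  F = functional (λ k → sgn k * D k)

  -- The power of `ι m` stays on the left because the identity for `W` carries the same factor on
  -- `falling j`; it never has to be divided out.
  F-falling : ∀ j → ι m ^ j * F (falling j) ≡ sgn j * L j
  F-falling j = begin
    ι m ^ j * F (falling j)
      ≡⟨ functional-const-* _ (ι m ^ j) (falling j) ⟨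
    F (const (ι m ^ j) *ᴾ falling j)
      ≡⟨ functional-expansion _ j (λ i → sgn (j ∸ i) * w j i) (linear m r ^ᴾ_)
           (const (ι m ^ j) *ᴾ falling j) (isFirst j) ⟩
    ∑[ 0 ⋯ j ] (λ i → sgn (j ∸ i) * w j i * F (linear m r ^ᴾ i))
      ≡⟨ ∑-cong j (λ i i≤j → begin
           sgn (j ∸ i) * w j i * F (linear m r ^ᴾ i)
             ≡⟨ cong (sgn (j ∸ i) * w j i *_) (functional-ℓ^ _ i) ⟩
           sgn (j ∸ i) * w j i * (sgn i * D i)
             ≡⟨ solve 4 (λ s x t d → s :* x :* (t :* d) := s :* t :* (x :* d))
                  refl (sgn (j ∸ i)) (w j i) (sgn i) (D i) ⟩
           sgn (j ∸ i) * sgn i * (w j i * D i)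
             ≡⟨ cong (_* (w j i * D i)) (sgn-∸-* i≤j) ⟩
           sgn j * (w j i * D i) ∎) ⟩
    ∑[ 0 ⋯ j ] (λ i → sgn j * (w j i * D i))
      ≡⟨ *-distribˡ-∑ 0 j (sgn j) (λ i → w j i * D i) ⟨
    sgn j * ∑[ 0 ⋯ j ] (λ i → w j i * D i)
      ≡⟨ cong (sgn j *_) (∑-whitneyLah w W j) ⟨
    sgn j * L j ∎

  signed-dowling : sgn n * D n ≡ ∑[ 0 ⋯ n ] (λ j → W n j * (sgn j * L j))
  signed-dowling = begin
    sgn n * D n
      ≡⟨ functional-ℓ^ _ n ⟨
    F (linear m r ^ᴾ n)
      ≡⟨ functional-expansion _ n (λ j → ι m ^ j * W n j) falling (linear m r ^ᴾ n) (isSecond n) ⟩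
    ∑[ 0 ⋯ n ] (λ j → ι m ^ j * W n j * F (falling j))
      ≡⟨ ∑-cong n (λ j _ → trans
           (solve 3 (λ t x y → t :* x :* y := x :* (t :* y))
             refl (ι m ^ j) (W n j) (F (falling j)))
           (cong (W n j *_) (F-falling j))) ⟩
    ∑[ 0 ⋯ n ] (λ j → W n j * (sgn j * L j)) ∎
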